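{- Let $n \ge 5$ and let $T$ be a tree with vertex set $\{1,2,\ldots,n\}$ that is a star or a path. Then the AK algorithm on $T$ sorts any permutation using the minimum number of transpositions; that is, for every $\pi \in S_n$, every run of the AK algorithm on $T$ starting from $\pi$ uses exactly $\mathrm{dist}_{\Gamma}(I,\pi)$ transpositions, where $\Gamma$ is the Cayley graph of $S_n$ generated by $T$.
   Context: $S_n$ is the symmetric group on $\{1,\ldots,n\}$ and $I$ is its identity; the product $\pi\tau$ means apply $\tau$ first, then $\pi$. For a tree $T$ on vertex set $\{1,\ldots,n\}$ (a transposition tree), each edge $ij$ is identified with the transposition $(i,j)$, and the Cayley graph $\Gamma$ generated by $T$ is the simple undirected graph with vertex set $S_n$ in which $g$ and $h$ are adjacent iff $h = gs$ for some transposition $s$ that is an edge of $T$. $\mathrm{dist}_\Gamma$ is the distance in $\Gamma$. AK algorithm: given $T$ and $\pi \in S_n$, place marker $\pi(k)$ at each vertex $k$ of $T$. Applying the switch $(i,j)$ for an edge $ij$ of $T$ interchanges the markers at $i$ and $j$, i.e. replaces $\pi$ by $\pi(i,j)$. A marker $k$ is homed if it is at vertex $k$. An edge $ij$ of $T$ is admissible for the current permutation $\pi$ if one of the following holds: (type A) applying the switch $(i,j)$ reduces the distance in $T$ from the marker at $i$ to its home vertex $\pi(i)$ and also reduces the distance from the marker at $j$ to its home vertex $\pi(j)$; or (type B) the marker at one of $i,j$ is homed, and the marker at the other vertex is not homed and applying the switch $(i,j)$ would reduce its distance to its home vertex (i.e. it needs to traverse the edge $ij$ on its way home). Whenever $\pi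 \ne I$ there is at least one admissible edge. A run of the AK algorithm from $\pi$ repeatedly chooses any admissible edge for the current permutation and applies the corresponding switch, until the current permutation is $I$ (every run terminates). The number of transpositions used is the number of switches applied. -}

module Defs where

open import Data.Fin.Base using (Fin; zero; suc; toℕ; inject₁; fromℕ)
open import Data.Fin.Permutation
  using (Permutation′; _⟨$⟩ʳ_; _⟨$⟩ˡ_; inverseˡ; _∘ₚ_; transpose; id; _≈_)
import Data.Fin.Permutation.Components as PC
open import Data.Fin.Properties using (_≟_)
open import Data.Nat.Base using (ℕ; zero; suc; _≤_; _<_)
open import Data.Product.Base using (Σ-syntax; ∃-syntax; _×_; _,_)
open import Data.Sum.Base using (_⊎_)
open import Function.Bundles using (_⇔_)
open import Function.Definitions using (Injective)
open import Level using (0ℓ)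
open import Relation.Binary.Bundles using (Setoid)
open import Relation.Binary.Core using (Rel)
open import Relation.Binary.Definitions
  using (Symmetric; Irreflexive; _Respects₂_)
open import Relation.Binary.PropositionalEquality
  using (_≡_; _≢_; refl; sym; trans; cong; setoid)
open import Relation.Nullary.Decidable using (dec-true)
open import Relation.Nullary.Negation using (¬_)

private
  variable
    n k : ℕ

-- Simple undirected graphs.  Vertices form a setoid because permutations
-- are compared pointwise.
record Graph (V : Setoid 0ℓ 0ℓ) : Set₁ where
  open Setoid V using (Carrier) renaming (_≈_ to _≈ᵥ_)
  field
    Adj        : Rel Carrier 0ℓ
    adj-resp   : Adj Respects₂ _≈ᵥ_
    adj-sym    : Symmetric Adj
    adj-irrefl : Irreflexive _≈ᵥ_ Adj

module _ {V : Setoid 0ℓ 0ℓ} (G : Graph V) where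
  open Setoid V using (Carrier) renaming (_≈_ to _≈ᵥ_)
  open Graph G

  data Walk : Carrier → Carrier → ℕ → Set where
    here : ∀ {u v} → u ≈ᵥ v → Walk u v zero
    step : ∀ {u v w k} → Adj u v → Walk v w k → Walk u w (suc k)

  -- dist(u , v) = d
  IsDist : Carrier → Carrier → ℕ → Set
  IsDist u v d = Walk u v d × (∀ k → Walk u v k → d ≤ k)

  Connected : Set
  Connected = ∀ u v → ∃[ k ] Walk u v k

  -- c zero, …, c (fromℕ k) are the k + 1 ≥ 3 distinct vertices of a cycle.
  IsCycle : (Fin (suc k) → Carrier) → Set
  IsCycle {k} c =
    2 ≤ k ×
    Injective _≡_ _≈ᵥ_ c ×
    (∀ (i : Fin k) → Adj (c (inject₁ i)) (c (suc i))) ×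
    Adj (c (fromℕ k)) (c zero)

  Acyclic : Set
  Acyclic = ∀ k (c : Fin (suc k) → Carrier) → ¬ IsCycle c

  IsTree : Set
  IsTree = Connected × Acyclic

-- The vertex set {1,…,n} is represented by Fin n.
FinGraph : ℕ → Set₁
FinGraph n = Graph (setoid (Fin n))

IsStar : FinGraph n → Set
IsStar {n} T = Σ[ c ∈ Fin n ]
  (∀ i j → Adj i j ⇔ (i ≢ j × (i ≡ c ⊎ j ≡ c)))
  where open Graph T

-- σ lists the vertices in the order in which they occur along the path.
IsPath : FinGraph n → Set
IsPath {n} T = Σ[ σ ∈ Permutation′ n ]
  (∀ i j → Adj (σ ⟨$⟩ʳ i) (σ ⟨$⟩ʳ j) ⇔
           (toℕ j ≡ suc (toℕ i) ⊎ toℕ i ≡ suc (toℕ j)))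
  where open Graph T

infixl 7 _·_

-- The product π τ applies τ first, which is the opposite of the order of
-- the arguments of _∘ₚ_.
_·_ : Permutation′ n → Permutation′ n → Permutation′ n
π · τ = τ ∘ₚ π

permutationSetoid : ℕ → Setoid 0ℓ 0ℓ
permutationSetoid n = record
  { Carrier       = Permutation′ n
  ; _≈_           = _≈_
  ; isEquivalence = record
    { refl  = λ _ → refl
    ; sym   = λ p i → sym (p i)
    ; trans = λ p q i → trans (p i) (q i)
    }
  }

transpose-i≡j : (i j : Fin n) → transpose i j ⟨$⟩ʳ i ≡ j
transpose-i≡j i j rewrite dec-true (i ≟ i) refl = refl

module _ (T : FinGraph n) where
  open Graph T

  CayleyAdj : Rel (Permutation′ n) 0ℓ
  CayleyAdj g h = ∃[ i ] ∃[ j ] (Adj i j × h ≈ g · transpose i j)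

  Cayley : Graph (permutationSetoid n)
  Cayley = record
    { Adj        = CayleyAdj
    ; adj-resp   =
        (λ h≈h′ (i , j , a , e) → i , j , a , λ x → trans (sym (h≈h′ x)) (e x)) ,
        (λ g≈g′ (i , j , a , e) → i , j , a , λ x → trans (e x) (g≈g′ _))
    ; adj-sym    = λ {g} {h} (i , j , a , e) →
        j , i , adj-sym a , λ x →
          trans (sym (cong (g ⟨$⟩ʳ_) (PC.transpose-inverse i j)))
                (sym (e (PC.transpose j i x)))
    ; adj-irrefl = λ {g} {h} g≈h (i , j , a , e) →
        adj-irrefl
          (trans (sym (inverseˡ g))
          (trans (cong (g ⟨$⟩ˡ_) (trans (g≈h i) (e i)))
          (trans (inverseˡ g) (transpose-i≡j i j))))
          a
    }

  -- Moving marker m from vertex u to vertex v brings it closer to its home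
  -- vertex, which is also m.
  Approaches : (m u v : Fin n) → Set
  Approaches m u v = ∃[ d ] ∃[ d′ ] (IsDist T u m d × IsDist T v m d′ × d′ < d)

  -- Vertex k carries marker π ⟨$⟩ʳ k.
  Homed : Permutation′ n → Fin n → Set
  Homed π k = π ⟨$⟩ʳ k ≡ k

  TypeA : Permutation′ n → Fin n → Fin n → Set
  TypeA π i j = Approaches (π ⟨$⟩ʳ i) i j × Approaches (π ⟨$⟩ʳ j) j i

  -- The marker at i is the homed one.
  TypeB : Permutation′ n → Fin n → Fin n → Set
  TypeB π i j = Homed π i × ¬ Homed π j × Approaches (π ⟨$⟩ʳ j) j i

  Admissible : Permutation′ n → Fin n → Fin n → Set
  Admissible π i j = Adj i j × (TypeA π i j ⊎ TypeB π i j ⊎ TypeB π j i)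

  -- AKRun π k: a run of the AK algorithm that starts from π and uses k
  -- switches.
  data AKRun (π : Permutation′ n) : ℕ → Set where
    sorted : π ≈ id → AKRun π zero
    switch : ∀ {k} i j → ¬ π ≈ id → Admissible π i j →
             AKRun (π · transpose i j) k → AKRun π (suc k)

{-# OPTIONS --safe #-}

-- To each permutation π one attaches certificates, each with a size: a walk of
-- length l from π to id yields a certificate for π of size l, and an admissible
-- switch at π turns a certificate of size l for π into one of size l - 1 for
-- the switched permutation.  Hence no walk is shorter than a run.
--
-- On a path a certificate is a list that contains all inversions; every
-- admissible switch undoes an inversion.  On a star with centre
-- c it is a weight on the vertices (how often the edge to that leaf is used)
-- that is positive on the misplaced leaves, and at least 2 somewhere on each
-- nontrivial cycle avoiding c: if each edge from c to the cycle were used only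
-- once, then the leaf used first would end up with a marker from outside the
-- cycle.  An admissible switch either homes the marker at c or absorbs such a
-- cycle into that of c, and in both cases one unit of weight is released.
module Submission where

open import Defs
open import Data.Fin.Permutation using (Permutation′; id)
open import Data.Nat.Base using (ℕ; _≤_)
open import Data.Sum.Base using (_⊎_)

open import Data.Empty using (⊥-elim)
open import Data.Fin.Base using (Fin; zero; suc; toℕ)
open import Data.Fin.Permutation
  using (_⟨$⟩ʳ_; _⟨$⟩ˡ_; inverseʳ; transpose; _≈_)
open import Data.Fin.Properties using (_≟_; toℕ-injective)
open import Data.List.Base using (List; []; _∷_; length)
open import Data.List.Membership.Propositional using (_∈_)
open import Data.List.Membership.Propositional.Properties using (∈-∃++)
open import Data.List.Relation.Binary.Permutation.Propositional
  using (_↭_)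
open import Data.List.Relation.Binary.Permutation.Propositional.Properties
  using (shift; ∈-resp-↭; ↭-length)
open import Data.List.Relation.Unary.Any using (here; there)
open import Data.Nat.Base using (zero; suc; pred; _+_; _<_; z≤n; s≤s)
open import Data.Nat.Properties
  using (_≤?_; _<?_; ≤-refl; ≤-reflexive; <-trans; <⇒≤; <⇒≱; ≰⇒>; n≮0;
         n≮n; m<n⇒m<1+n; ≤∧≢⇒<; <-≤-trans; ≤-<-trans; +-suc; <-asym;
         pred-mono-≤)
open import Data.Product.Base using (Σ-syntax; ∃-syntax; _×_; _,_; proj₁; proj₂)
open import Data.Sum.Base using (inj₁; inj₂; [_,_]′)
open import Data.Vec.Functional using (Vector; foldr; updateAt)
open import Data.Vec.Functional.Properties
  using (updateAt-updates; updateAt-minimal)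
open import Function.Base using (_∘_)
open import Function.Bundles using (Injection; Equivalence)
open import Function.Definitions using (Injective)
open import Function.Properties.Inverse using (↔⇒↣)
open import Level using (Level; 0ℓ) renaming (suc to lsuc)
open import Relation.Binary.Bundles using (Setoid)
open import Relation.Binary.PropositionalEquality
  using (_≡_; _≢_; refl; sym; trans; cong; subst; subst₂)
open import Relation.Nullary.Decidable
  using (yes; no; dec-true; dec-false; decidable-stable)
open import Relation.Nullary.Negation using (¬_; contradiction)

private
  variable
    n k l : ℕ

-- Walks and distances

module _ {V : Setoid 0ℓ 0ℓ} (G : Graph V) where
  open Setoid V using (Carrier) renaming (sym to ≈-sym; refl to ≈-refl)
  open Graph G

  walk-snoc : ∀ {u v w} → Walk G u v k → Adj v w → Walk G u w (suc k)
  walk-snoc (here u≈v)   v~w = step (proj₂ adj-resp (≈-sym u≈v) v~w) (here ≈-refl)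
  walk-snoc (step a u⟶v) v~w = step a (walk-snoc u⟶v v~w)

  walk-reverse : ∀ {u v} → Walk G u v k → Walk G v u k
  walk-reverse (here u≈v)   = here (≈-sym u≈v)
  walk-reverse (step a w⟶v) = walk-snoc (walk-reverse w⟶v) (adj-sym a)

module _ (T : FinGraph n) where
  open Graph T

  -- Stands in for a union of branches at `u`, without constructing the components that remain when
  -- `u` is removed.
  ExitsOnlyAt : Fin n → (Fin n → Set) → Set
  ExitsOnlyAt u S = ∀ {x y} → S x → Adj x y → S y ⊎ y ≡ u

  -- The walk has to leave `S`, hence passes through `u`; the remainder from there is strictly
  -- shorter because at least one step has been taken.
  exit-shortens : ∀ {S u m w} → ExitsOnlyAt u S → ¬ S m → S w →
                  Walk T w m k → ∃[ k′ ] k′ < k × Walk T u m k′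
  exit-shortens exit ¬Sm Sw (here refl)      = contradiction Sw ¬Sm
  exit-shortens exit ¬Sm Sw (step w~x x⟶m) with exit Sw w~x
  ... | inj₂ refl = _ , ≤-refl , x⟶m
  ... | inj₁ Sx   =
    let k′ , k′<k , u⟶m = exit-shortens exit ¬Sm Sx x⟶m
    in k′ , m<n⇒m<1+n k′<k , u⟶m

  -- If `m` lay outside `S`, a shortest walk from `v` to `m` would pass through `u`, putting `u`
  -- nearer to `m` than `v` is. The double negation is there because `S` need not be decidable.
  approaches-inside : ∀ {S m u v} → ExitsOnlyAt u S → S v →
                      Approaches T m u v → ¬ ¬ S m
  approaches-inside exit Sv (d , d′ , (_ , d-min) , (v⟶m , _) , d′<d) ¬Sm =
    let k′ , k′<d′ , u⟶m = exit-shortens exit ¬Sm Sv v⟶m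
    in <⇒≱ (<-trans k′<d′ d′<d) (d-min k′ u⟶m)

  approaches-≢ : ∀ {m u v} → Approaches T m u v → m ≢ u
  approaches-≢ (d , d′ , (_ , d-min) , _ , d′<d) refl =
    n≮0 (<-≤-trans d′<d (d-min 0 (here refl)))

  adj-≢ : ∀ {i j} → Adj i j → i ≢ j
  adj-≢ i~j i≡j = adj-irrefl i≡j i~j

  admissible-sym : ∀ π {i j} → Admissible T π i j → Admissible T π j i
  admissible-sym π (i~j , inj₁ (a , a′))  = adj-sym i~j , inj₁ (a′ , a)
  admissible-sym π (i~j , inj₂ (inj₁ b)) = adj-sym i~j , inj₂ (inj₂ b)
  admissible-sym π (i~j , inj₂ (inj₂ b)) = adj-sym i~j , inj₂ (inj₁ b)

-- Switches as maps

ʳ-injective : (π : Permutation′ n) → Injective _≡_ _≡_ (π ⟨$⟩ʳ_)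
ʳ-injective π = Injection.injective (↔⇒↣ π)

-- A pointwise relation, symmetric in `g` and `h` and in `i` and `j`, so that the same lemmas serve
-- both directions of a switch and both orientations of an edge.
Switched : (g h : Fin n → Fin n) (i j : Fin n) → Set
Switched g h i j =
  h i ≡ g j × h j ≡ g i × (∀ x → x ≢ i → x ≢ j → h x ≡ g x)

switched-flip : ∀ {g h : Fin n → Fin n} {i j} → Switched g h i j → Switched g h j i
switched-flip (hi , hj , hx) = hj , hi , λ x x≢j x≢i → hx x x≢i x≢j

switched-sym : ∀ {g h : Fin n → Fin n} {i j} → Switched g h i j → Switched h g i j
switched-sym (hi , hj , hx) = sym hj , sym hi , λ x x≢i x≢j → sym (hx x x≢i x≢j)

transpose-j≡i : (i j : Fin n) → transpose i j ⟨$⟩ʳ j ≡ i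
transpose-j≡i i j with j ≟ i
... | yes j≡i = j≡i
... | no  _   rewrite dec-true (j ≟ j) refl = refl

transpose-fixes : ∀ {i j x : Fin n} → x ≢ i → x ≢ j → transpose i j ⟨$⟩ʳ x ≡ x
transpose-fixes {i = i} {j} {x} x≢i x≢j
  rewrite dec-false (x ≟ i) x≢i | dec-false (x ≟ j) x≢j = refl

switched-· : ∀ g h {i j : Fin n} → h ≈ g · transpose i j →
             Switched (g ⟨$⟩ʳ_) (h ⟨$⟩ʳ_) i j
switched-· g h {i} {j} h≈ =
    trans (h≈ i) (cong (g ⟨$⟩ʳ_) (transpose-i≡j i j))
  , trans (h≈ j) (cong (g ⟨$⟩ʳ_) (transpose-j≡i i j))
  , λ x x≢i x≢j → trans (h≈ x) (cong (g ⟨$⟩ʳ_) (transpose-fixes x≢i x≢j))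

-- Runs against certificates

module _ (T : FinGraph n) where

  run⇒walk : ∀ {π} → AKRun T π k → Walk (Cayley T) π id k
  run⇒walk (sorted π≈id)                  = here π≈id
  run⇒walk (switch i j _ (i~j , _) run) =
    step (i , j , i~j , λ _ → refl) (run⇒walk run)

  record CertificateSystem (a : Level) : Set (lsuc a) where
    field
      Certificate : Permutation′ n → ℕ → Set a
      trivial     : ∀ {π} → π ≈ id → Certificate π 0
      extend      : ∀ {g h l} → CayleyAdj T g h →
                    Certificate h l → Certificate g (suc l)
      -- The double negation allows for an unspecified choice: on a star the vertex that gives up
      -- weight is not always exhibited.
      consume     : ∀ {π i j l} → Admissible T π i j → Certificate π l →
                    ¬ ¬ (∃[ l′ ] l ≡ suc l′ × Certificate (π · transpose i j) l′)

  module _ {a} (C : CertificateSystem a) where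
    open CertificateSystem C

    walk⇒certificate : ∀ {π τ} → τ ≈ id → Walk (Cayley T) π τ l → Certificate π l
    walk⇒certificate τ≈id (here π≈τ)     = trivial (λ x → trans (π≈τ x) (τ≈id x))
    walk⇒certificate τ≈id (step g~h h⟶τ) = extend g~h (walk⇒certificate τ≈id h⟶τ)

    run≤certificate : ∀ {π} → AKRun T π k → Certificate π l → k ≤ l
    run≤certificate (sorted _) _ = z≤n
    run≤certificate {l = l} (switch {k} i j _ adm run) c =
      -- The comparison is decidable, which removes the double negation left by `consume`.
      decidable-stable (suc k ≤? l) λ ¬k<l →
        consume adm c λ where
          (l′ , refl , c′) → ¬k<l (s≤s (run≤certificate run c′))

    -- The run is itself a walk, and certificates bound every walk from below. Walks are reversed
    -- because certificates are built from walks towards `id`.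
    run-optimal : ∀ {π} → AKRun T π k → IsDist (Cayley T) id π k
    run-optimal run =
        walk-reverse (Cayley T) (run⇒walk run)
      , λ _ id⟶π → run≤certificate run
          (walk⇒certificate (λ _ → refl) (walk-reverse (Cayley T) id⟶π))

-- Paths

extract : ∀ {a} {A : Set a} {x : A} {xs} → x ∈ xs → ∃[ ys ] xs ↭ x ∷ ys
extract x∈xs with ys , zs , refl ← ∈-∃++ x∈xs = _ , shift _ ys zs

-- Inversions with respect to a numbering of the vertices

module _ (p : Fin n → ℕ) where

  -- Entries are pairs of markers, larger first, rather than pairs of vertices, so a switch affects
  -- a single pair. Extra entries are allowed, since a step of an arbitrary walk may add a pair that
  -- is no inversion.
  CoversInversions : (Fin n → Fin n) → List (Fin n × Fin n) → Set
  CoversInversions g L =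
    ∀ x y → p x < p y → p (g y) < p (g x) → (g x , g y) ∈ L

  module _ (p-injective : Injective _≡_ _≡_ p)
           {i j : Fin n} (pj≡1+pi : p j ≡ suc (p i)) where

    pi<pj : p i < p j
    pi<pj = ≤-reflexive (sym pj≡1+pi)

    private
      <pj⇒<pi : ∀ {x} → x ≢ i → p x < p j → p x < p i
      <pj⇒<pi {x} x≢i px<pj with subst (p x <_) pj≡1+pi px<pj
      ... | s≤s px≤pi = ≤∧≢⇒< px≤pi (x≢i ∘ p-injective)

      pi<⇒pj< : ∀ {y} → y ≢ j → p i < p y → p j < p y
      pi<⇒pj< {y} y≢j pi<py =
        ≤∧≢⇒< (subst (_≤ p y) (sym pj≡1+pi) pi<py) (y≢j ∘ sym ∘ p-injective)

    -- Exchanging neighbouring positions reverses the order of one pair of markers only; all other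
    -- pairs keep their order.
    switched-pair : ∀ {g h x y} → Switched g h i j → p x < p y →
      (x ≡ i × y ≡ j) ⊎
      (∃[ x′ ] ∃[ y′ ] (p x′ < p y′ × h x ≡ g x′ × h y ≡ g y′ × ¬ (x′ ≡ i × y′ ≡ j)))
    switched-pair {x = x} {y} (hi , hj , hx) px<py with x ≟ i | x ≟ j | y ≟ i | y ≟ j
    ... | yes refl | _ | yes refl | _ = contradiction px<py (n≮n _)
    ... | yes refl | _ | no _ | yes refl = inj₁ (refl , refl)
    ... | yes refl | _ | no y≢i | no y≢j =
      inj₂ (j , y , pi<⇒pj< y≢j px<py , hi , hx y y≢i y≢j , λ (j≡i , _) →
        n≮n _ (subst (λ z → p i < p z) j≡i pi<pj))
    ... | no _ | yes refl | yes refl | _ = contradiction px<py (<-asym pi<pj)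
    ... | no _ | yes refl | no _ | yes refl = contradiction px<py (n≮n _)
    ... | no _ | yes refl | no y≢i | no y≢j =
      inj₂ (i , y , <-trans pi<pj px<py , hj , hx y y≢i y≢j , y≢j ∘ proj₂)
    ... | no x≢i | no x≢j | yes refl | _ =
      inj₂ (x , j , <-trans px<py pi<pj , hx x x≢i x≢j , hi , x≢i ∘ proj₁)
    ... | no x≢i | no x≢j | no _ | yes refl =
      inj₂ (x , i , <pj⇒<pi x≢i px<py , hx x x≢i x≢j , hj , x≢i ∘ proj₁)
    ... | no x≢i | no x≢j | no y≢i | no y≢j =
      inj₂ (x , y , px<py , hx x x≢i x≢j , hx y y≢i y≢j , x≢i ∘ proj₁)

    -- Apart from the pair on the switched edge, every inversion of `g` is already one of `h`.
    cover-add : ∀ {g h L} → Switched g h i j →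
                CoversInversions h L → CoversInversions g ((g i , g j) ∷ L)
    cover-add sw cover x y px<py inv with switched-pair (switched-sym sw) px<py
    ... | inj₁ (refl , refl) = here refl
    ... | inj₂ (x′ , y′ , px′<py′ , gx≡ , gy≡ , _) rewrite gx≡ | gy≡ =
      there (cover x′ y′ px′<py′ inv)

    -- The descent is an inversion, so one occurrence of it can be deleted. The inversions of `h`
    -- come from other vertex pairs, hence by injectivity from other marker pairs, and survive the
    -- deletion.
    cover-remove : ∀ {g h L} → Injective _≡_ _≡_ g → Switched g h i j →
                   p (g j) < p (g i) → CoversInversions g L →
                   ∃[ L′ ] length L ≡ suc (length L′) × CoversInversions h L′
    cover-remove {g} {h} g-injective sw@(hi , hj , _) descent cover
      with L′ , L↭ ← extract (cover i j pi<pj descent) =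
      L′ , ↭-length L↭ , cover′
      where
      cover′ : CoversInversions h L′
      cover′ x y px<py inv with switched-pair sw px<py
      ... | inj₁ (refl , refl) rewrite hi | hj = contradiction descent (<-asym inv)
      ... | inj₂ (x′ , y′ , px′<py′ , hx≡ , hy≡ , ¬ij) rewrite hx≡ | hy≡
        with ∈-resp-↭ L↭ (cover x′ y′ px′<py′ inv)
      ... | there ∈L′ = ∈L′
      ... | here eq   = contradiction
        (g-injective (cong proj₁ eq) , g-injective (cong proj₂ eq)) ¬ij

-- Admissible switches on a path

module _ (T : FinGraph n) (isPath : IsPath T) where
  open Graph T

  private
    σ = proj₁ isPath

  position : Fin n → ℕ
  position v = toℕ (σ ⟨$⟩ˡ v)

  position-injective : Injective _≡_ _≡_ position
  position-injective {x} {y} eq =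
    trans (sym (inverseʳ σ))
    (trans (cong (σ ⟨$⟩ʳ_) (toℕ-injective eq)) (inverseʳ σ))

  adj⇒consecutive : ∀ {u v} → Adj u v →
    position v ≡ suc (position u) ⊎ position u ≡ suc (position v)
  adj⇒consecutive u~v = Equivalence.to (proj₂ isPath _ _)
    (subst₂ Adj (sym (inverseʳ σ)) (sym (inverseʳ σ)) u~v)

  -- Positions change by exactly one along an edge, so a walk cannot jump over `u`.
  exits-above : ∀ u → ExitsOnlyAt T u (λ x → position u < position x)
  exits-above u {x} {y} u<x x~y with adj⇒consecutive x~y
  ... | inj₁ y≡1+x rewrite y≡1+x = inj₁ (m<n⇒m<1+n u<x)
  ... | inj₂ x≡1+y with y ≟ u | subst (position u <_) x≡1+y u<x
  ...   | yes y≡u | _        = inj₂ y≡u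
  ...   | no  y≢u | s≤s u≤y = inj₁ (≤∧≢⇒< u≤y (y≢u ∘ sym ∘ position-injective))

  exits-below : ∀ u → ExitsOnlyAt T u (λ x → position x < position u)
  exits-below u {x} {y} x<u x~y with adj⇒consecutive x~y
  ... | inj₂ x≡1+y = inj₁ (<-trans (≤-reflexive (sym x≡1+y)) x<u)
  ... | inj₁ y≡1+x with y ≟ u
  ...   | yes y≡u = inj₂ y≡u
  ...   | no  y≢u =
    inj₁ (≤∧≢⇒< (subst (_≤ position u) (sym y≡1+x) x<u) (y≢u ∘ position-injective))

  approaches-up : ∀ {m i j} → position i < position j →
                  Approaches T m i j → position i < position m
  approaches-up {m} {i} i<j =
    decidable-stable (position i <? position m) ∘
    approaches-inside T {λ x → position i < position x} (exits-above i) i<j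

  approaches-down : ∀ {m i j} → position i < position j →
                    Approaches T m j i → position m < position j
  approaches-down {m} {j = j} i<j =
    decidable-stable (position m <? position j) ∘
    approaches-inside T {λ x → position x < position j} (exits-below j) i<j

  -- In type A the markers have their homes on opposite sides of the edge, each on the other's side.
  -- In type B the homed marker sits at one end and the other home lies at or beyond that end;
  -- distinctness of markers gives strictness.
  admissible-descent : ∀ π {i j} → position j ≡ suc (position i) →
    Admissible T π i j → position (π ⟨$⟩ʳ j) < position (π ⟨$⟩ʳ i)
  admissible-descent π {i} {j} j≡1+i (i~j , kind) = descent kind
    where
    i<j : position i < position j
    i<j = ≤-reflexive (sym j≡1+i)

    ≤i : Approaches T (π ⟨$⟩ʳ j) j i → position (π ⟨$⟩ʳ j) ≤ position i
    ≤i a with subst (position (π ⟨$⟩ʳ j) <_) j≡1+i (approaches-down i<j a)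
    ... | s≤s πj≤i = πj≤i

    distinct : position (π ⟨$⟩ʳ j) ≢ position (π ⟨$⟩ʳ i)
    distinct = adj-≢ T i~j ∘ sym ∘ ʳ-injective π ∘ position-injective

    descent : TypeA T π i j ⊎ TypeB T π i j ⊎ TypeB T π j i →
              position (π ⟨$⟩ʳ j) < position (π ⟨$⟩ʳ i)
    descent (inj₁ (a , a′)) = ≤-<-trans (≤i a′) (approaches-up i<j a)
    descent (inj₂ (inj₁ (πi≡i , _ , a))) = ≤∧≢⇒<
      (subst (λ z → position (π ⟨$⟩ʳ j) ≤ position z) (sym πi≡i) (≤i a)) distinct
    -- As `position j` is the successor of `position i`, lying above `i` means lying at or above
    -- `j`.
    descent (inj₂ (inj₂ (πj≡j , _ , a))) = ≤∧≢⇒<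
      (subst₂ _≤_ (trans (sym j≡1+i) (cong position (sym πj≡j))) refl
        (approaches-up i<j a)) distinct

  InversionCertificate : Permutation′ n → ℕ → Set
  InversionCertificate π l =
    ∃[ L ] length L ≡ l × CoversInversions position (π ⟨$⟩ʳ_) L

  inversion-extend : ∀ {g h} → CayleyAdj T g h →
                     InversionCertificate h l → InversionCertificate g (suc l)
  inversion-extend {g = g} {h} (i , j , i~j , h≈) (L , refl , cover)
    with adj⇒consecutive i~j
  ... | inj₁ j≡1+i = _ , refl ,
    cover-add position position-injective j≡1+i (switched-· g h h≈) cover
  ... | inj₂ i≡1+j = _ , refl ,
    cover-add position position-injective i≡1+j (switched-flip (switched-· g h h≈)) cover

  inversion-consume : ∀ {π i j} → Admissible T π i j → InversionCertificate π l →
    ∃[ l′ ] l ≡ suc l′ × InversionCertificate (π · transpose i j) l′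
  inversion-consume {π = π} {i} {j} adm (L , refl , cover)
    with adj⇒consecutive (proj₁ adm)
       | switched-· π (π · transpose i j) {i} {j} (λ _ → refl)
  ... | inj₁ j≡1+i | sw =
    let L′ , len , cover′ = cover-remove position position-injective j≡1+i
          (ʳ-injective π) sw (admissible-descent π j≡1+i adm) cover
    in _ , len , L′ , refl , cover′
  ... | inj₂ i≡1+j | sw =
    let L′ , len , cover′ = cover-remove position position-injective i≡1+j
          (ʳ-injective π) (switched-flip sw)
          (admissible-descent π i≡1+j (admissible-sym T π adm)) cover
    in _ , len , L′ , refl , cover′

  inversionCertificates : CertificateSystem T 0ℓ
  inversionCertificates = record
    { Certificate = InversionCertificate
    ; trivial     = λ π≈id → [] , refl , λ x y x<y πy<πx →
        contradiction x<y
          (<-asym (subst₂ (λ a b → position a < position b) (π≈id y) (π≈id x) πy<πx))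
    ; extend      = λ {g} {h} → inversion-extend {g = g} {h}
    ; consume     = λ {π} adm cert ¬cert → ¬cert (inversion-consume {π = π} adm cert)
    }

-- Stars

sum : Vector ℕ n → ℕ
sum = foldr _+_ 0

sum-const-0 : ∀ n → sum {n} (λ _ → 0) ≡ 0
sum-const-0 zero    = refl
sum-const-0 (suc n) = sum-const-0 n

sum-increment : ∀ (t : Vector ℕ n) i → sum (updateAt t i suc) ≡ suc (sum t)
sum-increment t zero    = refl
sum-increment t (suc i) =
  trans (cong (t zero +_) (sum-increment (t ∘ suc) i)) (+-suc (t zero) _)

sum-decrement : ∀ (t : Vector ℕ n) i → 0 < t i →
                sum t ≡ suc (sum (updateAt t i pred))
sum-decrement t zero 0<t₀ with t zero | 0<t₀
... | suc _ | _ = refl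
sum-decrement t (suc i) 0<tᵢ =
  trans (cong (t zero +_) (sum-decrement (t ∘ suc) i 0<tᵢ)) (+-suc (t zero) _)

-- For a permutation `g` these sets are the unions of cycles.
record Closed (g : Fin n → Fin n) (C : Fin n → Set) : Set where
  constructor closed
  field
    forth : ∀ x → C x → C (g x)
    back  : ∀ x → C (g x) → C x

-- The cycle of j under g; the backward constructor avoids an appeal to
-- finiteness.
data Cycle (g : Fin n → Fin n) (j : Fin n) : Fin n → Set where
  start : Cycle g j j
  forth : ∀ x → Cycle g j x → Cycle g j (g x)
  back  : ∀ x → Cycle g j (g x) → Cycle g j x

-- A fixed point forms a cycle of its own, so neither `forth` nor `back` can reach it from another
-- vertex.
cycle-avoids-fixed : ∀ {g : Fin n → Fin n} {c j} → Injective _≡_ _≡_ g →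
                     g c ≡ c → j ≢ c → ¬ Cycle g j c
cycle-avoids-fixed {g = g} {c} {j} g-injective gc≡c j≢c cyc = avoids cyc refl
  where
  avoids : ∀ {y} → Cycle g j y → y ≢ c
  avoids start         y≡c  = j≢c y≡c
  avoids (forth x cyc) gx≡c = avoids cyc (g-injective (trans gx≡c (sym gc≡c)))
  avoids (back x cyc)  refl = avoids cyc gc≡c

-- Weights that cover the cycles of a permutation

module _ (c : Fin n) where

  -- For a permutation the least total is the number of moved leaves plus the number of nontrivial
  -- cycles avoiding `c`, the familiar star distance. Closed sets replace single cycles, so that one
  -- need not follow how a switch splits and merges cycles.
  record CoversCycles (g : Fin n → Fin n) (t : Vector ℕ n) : Set₁ where
    field
      leaf  : ∀ x → x ≢ c → g x ≢ x → 0 < t x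
      cycle : ∀ (C : Fin n → Set) → ¬ C c → Closed g C →
              ∀ x → C x → g x ≢ x → ¬ (∀ i → C i → t i ≤ 1)

  open CoversCycles

  module _ {g h : Fin n → Fin n} {j : Fin n} (j≢c : j ≢ c)
           (sw : Switched g h c j) where
    private
      hc = proj₁ sw
      hj = proj₁ (proj₂ sw)
      hx = proj₂ (proj₂ sw)

    -- A set closed under `g` that avoids `c` and has all weights at most 1 must also avoid `j`. On
    -- such a set both maps agree, so it would already violate the cover of `h`.
    weight-add : ∀ {t} → CoversCycles h t → CoversCycles g (updateAt t j suc)
    weight-add {t} cover .leaf x x≢c gx≢x with x ≟ j
    ... | yes refl rewrite updateAt-updates x {suc} t = s≤s z≤n
    ... | no x≢j rewrite updateAt-minimal x j {suc} t x≢j =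
      leaf cover x x≢c (gx≢x ∘ trans (sym (hx x x≢c x≢j)))
    weight-add {t} cover .cycle C ¬Cc (closed fo ba) x Cx gx≢x t≤1 =
      cycle cover C ¬Cc (closed fo′ ba′) x Cx hx≢x
        (λ i Ci → subst (_≤ 1) (updateAt-minimal i j t (C⇒≢j Ci)) (t≤1 i Ci))
      where
      -- With `j` in `C` the bound forces `t j` to be 0, so `h` fixes `j`; then `g` sends `c` to
      -- `j`, which pulls `c` into `C`.
      ¬Cj : ¬ C j
      ¬Cj Cj with subst (_≤ 1) (updateAt-updates j t) (t≤1 j Cj)
      ... | s≤s tj≤0 with h j ≟ j
      ...   | yes hj≡j = ¬Cc (ba c (subst C (sym (trans (sym hj) hj≡j)) Cj))
      ...   | no  hj≢j = n≮0 (<-≤-trans (leaf cover j j≢c hj≢j) tj≤0)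

      C⇒≢c : ∀ {y} → C y → y ≢ c
      C⇒≢c Cy refl = ¬Cc Cy

      C⇒≢j : ∀ {y} → C y → y ≢ j
      C⇒≢j Cy refl = ¬Cj Cy

      hx≢x : h x ≢ x
      hx≢x = gx≢x ∘ trans (sym (hx x (C⇒≢c Cx) (C⇒≢j Cx)))

      fo′ : ∀ y → C y → C (h y)
      fo′ y Cy = subst C (sym (hx y (C⇒≢c Cy) (C⇒≢j Cy))) (fo y Cy)

      ba′ : ∀ y → C (h y) → C y
      ba′ y Chy with y ≟ c | y ≟ j
      ... | yes refl | _        = ⊥-elim (¬Cj (ba j (subst C hc Chy)))
      ... | no _     | yes refl = ⊥-elim (¬Cc (ba c (subst C hj Chy)))
      ... | no y≢c   | no y≢j   = ba y (subst C (hx y y≢c y≢j) Chy)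

    -- The switch homes marker `j`, so leaf `j` no longer demands weight.
    weight-home : ∀ {t} → Injective _≡_ _≡_ g → g c ≡ j →
                  CoversCycles g t → CoversCycles h (updateAt t j pred)
    weight-home {t} g-injective gc≡j cover = record { leaf = leaf′ ; cycle = cycle′ }
      where
      hj≡j : h j ≡ j
      hj≡j = trans hj gc≡j

      leaf′ : ∀ x → x ≢ c → h x ≢ x → 0 < updateAt t j pred x
      leaf′ x x≢c hx≢x with x ≟ j
      ... | yes refl = contradiction hj≡j hx≢x
      ... | no x≢j rewrite updateAt-minimal x j {pred} t x≢j =
        leaf cover x x≢c (hx≢x ∘ trans (hx x x≢c x≢j))

      cycle′ : ∀ C → ¬ C c → Closed h C → ∀ x → C x → h x ≢ x →
               ¬ (∀ i → C i → updateAt t j pred i ≤ 1)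
      -- `C` may contain `j`, a fixed point of `h` that lies on the cycle of `c` under `g`; removing
      -- it gives a set closed under `g` on which the weights are unchanged.
      cycle′ C ¬Cc (closed fo ba) x Cx hx≢x t≤1 =
        cycle cover C∖j (¬Cc ∘ proj₁) (closed fo′ ba′) x (Cx , x≢j)
          (hx≢x ∘ trans (hx x (C⇒≢c Cx) x≢j))
          (λ i (Ci , i≢j) → subst (_≤ 1) (updateAt-minimal i j t i≢j) (t≤1 i Ci))
        where
        C∖j : Fin n → Set
        C∖j y = C y × y ≢ j

        C⇒≢c : ∀ {y} → C y → y ≢ c
        C⇒≢c Cy refl = ¬Cc Cy

        x≢j : x ≢ j
        x≢j refl = hx≢x hj≡j

        fo′ : ∀ y → C∖j y → C∖j (g y)
        fo′ y (Cy , y≢j) =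
            subst C (hx y (C⇒≢c Cy) y≢j) (fo y Cy)
          , λ gy≡j → C⇒≢c Cy (g-injective (trans gy≡j (sym gc≡j)))

        ba′ : ∀ y → C∖j (g y) → C∖j y
        ba′ y (Cgy , gy≢j) with y ≟ c | y ≟ j
        ... | yes refl | _        = contradiction gc≡j gy≢j
        ... | no _     | yes refl = ⊥-elim (¬Cc (ba c (subst C (sym hc) Cgy)))
        ... | no y≢c   | no y≢j   = ba y (subst C (sym (hx y y≢c y≢j)) Cgy) , y≢j

    -- In h the cycle of j under g is part of the cycle of c.
    cycle-outside : ∀ {C} → g c ≡ c → Injective _≡_ _≡_ g → ¬ C c → Closed h C →
                    ∀ {y} → Cycle g j y → ¬ C y
    cycle-outside {C} gc≡c g-injective ¬Cc (closed fo ba) = outside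
      where
      ¬Cj : ¬ C j
      ¬Cj Cj = ¬Cc (subst C (trans hj gc≡c) (fo j Cj))

      outside : ∀ {y} → Cycle g j y → ¬ C y
      outside start Cj = ¬Cj Cj
      outside (forth y cyc) Cgy with y ≟ c | y ≟ j
      ... | yes refl | _        = cycle-avoids-fixed g-injective gc≡c j≢c cyc
      ... | no _     | yes refl = ¬Cc (ba c (subst C (sym hc) Cgy))
      ... | no y≢c   | no y≢j   =
        outside cyc (ba y (subst C (sym (hx y y≢c y≢j)) Cgy))
      outside (back y cyc) Cy with y ≟ c | y ≟ j
      ... | yes refl | _        = ¬Cc Cy
      ... | no _     | yes refl = ¬Cj Cy
      ... | no y≢c   | no y≢j   = outside cyc (subst C (hx y y≢c y≢j) (fo y Cy))

    -- Once the cycle of `j` has joined that of `c`, no closed set avoiding `c` meets it, so its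
    -- surplus unit can be released at `i`; the weight there stays positive.
    weight-absorb : ∀ {t i} → Injective _≡_ _≡_ g → g c ≡ c → g j ≢ j →
                    Cycle g j i → 1 < t i →
                    CoversCycles g t → CoversCycles h (updateAt t i pred)
    weight-absorb {t} {i} g-injective gc≡c gj≢j i∈cycle 1<ti cover =
      record { leaf = leaf′ ; cycle = cycle′ }
      where
      moved : ∀ x → x ≢ c → h x ≢ x → g x ≢ x
      moved x x≢c hx≢x with x ≟ j
      ... | yes refl = gj≢j
      ... | no x≢j   = hx≢x ∘ trans (hx x x≢c x≢j)

      leaf′ : ∀ x → x ≢ c → h x ≢ x → 0 < updateAt t i pred x
      leaf′ x x≢c hx≢x with x ≟ i
      ... | yes refl rewrite updateAt-updates x {pred} t = pred-mono-≤ 1<ti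
      ... | no x≢i rewrite updateAt-minimal x i {pred} t x≢i =
        leaf cover x x≢c (moved x x≢c hx≢x)

      cycle′ : ∀ C → ¬ C c → Closed h C → ∀ x → C x → h x ≢ x →
               ¬ (∀ y → C y → updateAt t i pred y ≤ 1)
      cycle′ C ¬Cc clo@(closed fo ba) x Cx hx≢x t≤1 =
        cycle cover C ¬Cc (closed fo′ ba′) x Cx (moved x (C⇒≢c Cx) hx≢x)
          (λ y Cy → subst (_≤ 1) (updateAt-minimal y i t (C⇒≢i Cy)) (t≤1 y Cy))
        where
        outside : ∀ {y} → Cycle g j y → ¬ C y
        outside = cycle-outside gc≡c g-injective ¬Cc clo

        C⇒≢c : ∀ {y} → C y → y ≢ c
        C⇒≢c Cy refl = ¬Cc Cy

        C⇒≢j : ∀ {y} → C y → y ≢ j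
        C⇒≢j Cy refl = outside start Cy

        C⇒≢i : ∀ {y} → C y → y ≢ i
        C⇒≢i Cy refl = outside i∈cycle Cy

        fo′ : ∀ y → C y → C (g y)
        fo′ y Cy = subst C (hx y (C⇒≢c Cy) (C⇒≢j Cy)) (fo y Cy)

        ba′ : ∀ y → C (g y) → C y
        ba′ y Cgy with y ≟ c | y ≟ j
        ... | yes refl | _        = subst C gc≡c Cgy
        ... | no _     | yes refl = ⊥-elim (outside (forth j start) Cgy)
        ... | no y≢c   | no y≢j   = ba y (subst C (sym (hx y y≢c y≢j)) Cgy)

-- Admissible switches on a star

module _ (T : FinGraph n) (isStar : IsStar T) where
  open Graph T

  private
    c = proj₁ isStar

  adj⇒centre : ∀ {i j} → Adj i j → i ≡ c ⊎ j ≡ c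
  adj⇒centre i~j = proj₂ (Equivalence.to (proj₂ isStar _ _) i~j)

  -- The only neighbour of leaf `j` is the centre, so `j` alone is a branch at `c`.
  approaches-leaf : ∀ {m j} → j ≢ c → Approaches T m c j → m ≡ j
  approaches-leaf {m} {j} j≢c = decidable-stable (m ≟ j) ∘ approaches-inside T exit refl
    where
    exit : ExitsOnlyAt T c (_≡ j)
    exit refl j~y = [ (λ j≡c → contradiction j≡c j≢c) , inj₂ ]′ (adj⇒centre j~y)

  CycleCertificate : Permutation′ n → ℕ → Set₁
  CycleCertificate π l = Σ[ t ∈ Vector ℕ n ] sum t ≡ l × CoversCycles c (π ⟨$⟩ʳ_) t

  cycle-extend : ∀ {g h} → CayleyAdj T g h →
                 CycleCertificate h l → CycleCertificate g (suc l)
  cycle-extend {g = g} {h} (i , j , i~j , h≈) (t , refl , cover)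
    with adj⇒centre i~j
  ... | inj₁ refl = _ , sum-increment t j ,
    weight-add c (adj-≢ T i~j ∘ sym) (switched-· g h h≈) cover
  ... | inj₂ refl = _ , sum-increment t i ,
    weight-add c (adj-≢ T i~j) (switched-flip (switched-· g h h≈)) cover

  -- Type A homes the marker at the centre; type B with the centre homed absorbs the cycle of `j`;
  -- type B with the leaf homed cannot occur.
  centre-consume : ∀ {π τ j} → Switched (π ⟨$⟩ʳ_) (τ ⟨$⟩ʳ_) c j →
    Admissible T π c j → CycleCertificate π l →
    ¬ ¬ (∃[ l′ ] l ≡ suc l′ × CycleCertificate τ l′)
  centre-consume {π = π} {τ} {j} sw (c~j , kind) (t , refl , cover) = by kind
    where
    j≢c : j ≢ c
    j≢c = adj-≢ T c~j ∘ sym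

    by : TypeA T π c j ⊎ TypeB T π c j ⊎ TypeB T π j c →
         ¬ ¬ (∃[ l′ ] sum t ≡ suc l′ × CycleCertificate τ l′)
    by (inj₁ (a , a′)) ¬cert = ¬cert
      (_ , sum-decrement t j (CoversCycles.leaf cover j j≢c (approaches-≢ T a′)) ,
       _ , refl , weight-home c j≢c sw (ʳ-injective π) (approaches-leaf j≢c a) cover)
    -- If no vertex on the cycle of `j` could release a unit, all its weights would be at most 1,
    -- against the cover.
    by (inj₂ (inj₁ (πc≡c , πj≢j , _))) ¬cert =
      CoversCycles.cycle cover (Cycle (π ⟨$⟩ʳ_) j)
        (cycle-avoids-fixed (ʳ-injective π) πc≡c j≢c)
        (closed forth back) j start πj≢j light
      where
      light : ∀ i → Cycle (π ⟨$⟩ʳ_) j i → t i ≤ 1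
      light i i∈cycle = decidable-stable (t i ≤? 1) λ ti≰1 → ¬cert
        (_ , sum-decrement t i (<⇒≤ (≰⇒> ti≰1)) ,
         _ , refl , weight-absorb c j≢c sw (ʳ-injective π) πc≡c πj≢j i∈cycle
                      (≰⇒> ti≰1) cover)
    -- Both `c` and `j` would carry marker `j`.
    by (inj₂ (inj₂ (πj≡j , _ , a))) _ =
      j≢c (ʳ-injective π (trans πj≡j (sym (approaches-leaf j≢c a))))

  cycle-consume : ∀ {π i j} → Admissible T π i j → CycleCertificate π l →
    ¬ ¬ (∃[ l′ ] l ≡ suc l′ × CycleCertificate (π · transpose i j) l′)
  cycle-consume {π = π} {i} {j} adm cert
    with adj⇒centre (proj₁ adm)
       | switched-· π (π · transpose i j) {i} {j} (λ _ → refl)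
  ... | inj₁ refl | sw = centre-consume {π = π} {τ = π · transpose i j} sw adm cert
  ... | inj₂ refl | sw = centre-consume {π = π} {τ = π · transpose i j}
    (switched-flip sw) (admissible-sym T π adm) cert

  cycleCertificates : CertificateSystem T (lsuc 0ℓ)
  cycleCertificates = record
    { Certificate = CycleCertificate
    ; trivial     = λ π≈id → (λ _ → 0) , sum-const-0 n , record
        { leaf  = λ x _ πx≢x → contradiction (π≈id x) πx≢x
        ; cycle = λ _ _ _ x _ πx≢x _ → πx≢x (π≈id x)
        }
    ; extend      = λ {g} {h} → cycle-extend {g = g} {h}
    ; consume     = λ {π} → cycle-consume {π = π}
    }

theorem9 : (n : ℕ) → 5 ≤ n →
    (T : FinGraph n) → IsTree T → IsStar T ⊎ IsPath T →
    (π : Permutation′ n) (k : ℕ) → AKRun T π k → IsDist (Cayley T) id π k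
theorem9 n _ T _ (inj₁ isStar) π k = run-optimal T (cycleCertificates T isStar)
theorem9 n _ T _ (inj₂ isPath) π k = run-optimal T (inversionCertificates T isPath)
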